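{- Let $(I,\preccurlyeq)$ be a directed set, let $S(\Lambda^{\preccurlyeq})$ be a direct spectrum over $(I,\preccurlyeq)$ with sets $\lambda_0(i)$, transports $\lambda^{\preccurlyeq}_{ij}$ and Bishop spaces $\mathcal F_i=(\lambda_0(i),F_i)$, let $S(M^{\preccurlyeq})$ be a direct spectrum over $(I,\preccurlyeq)$ with sets $\mu_0(i)$, transports $\mu^{\preccurlyeq}_{ij}$ and Bishop spaces $\mathcal G_i=(\mu_0(i),G_i)$, and let $\Psi:S(\Lambda^{\preccurlyeq})\Rightarrow S(M^{\preccurlyeq})$ be a direct spectrum-map. Then: (i) there is a unique function $\Psi_{\to}:\underset{\to}{\mathrm{Lim}}\,\lambda_0(i)\to\underset{\to}{\mathrm{Lim}}\,\mu_0(i)$ such that $\Psi_{\to}\circ\mathrm{eql}^{\Lambda^{\preccurlyeq}}_i=\mathrm{eql}^{M^{\preccurlyeq}}_i\circ\Psi_i$ for every $i\in I$; (ii) if $\Psi$ is continuous, then $\Psi_{\to}\in\mathrm{Mor}(\underset{\to}{\mathrm{Lim}}\,\mathcal F_i,\underset{\to}{\mathrm{Lim}}\,\mathcal G_i)$; (iii) if $\Psi_i$ is an embedding for every $i\in I$, then $\Psi_{\to}$ is an embedding.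
   Context: Work in Bishop-style constructive mathematics. Each set carries its own equality; functions respect equalities; $f$ is an embedding if $f(x)=f(x')$ implies $x=x'$. A directed set $(I,\preccurlyeq)$: a set with a reflexive transitive relation respecting equality, any two elements having a common upper bound. A direct family over $(I,\preccurlyeq)$: sets $\lambda_0(i)$ and functions $\lambda^{\preccurlyeq}_{ij}:\lambda_0(i)\to\lambda_0(j)$ for $i\preccurlyeq j$ with $\lambda^{\preccurlyeq}_{ii}=\mathrm{id}$ and $\lambda^{\preccurlyeq}_{ik}=\lambda^{\preccurlyeq}_{jk}\circ\lambda^{\preccurlyeq}_{ij}$. Bishop spaces: $\mathrm{Bic}(\mathbb R)$ = functions $\mathbb R\to\mathbb R$ uniformly continuous on each $[-n,n]$. A Bishop topology on $X$ is a set $F$ of functions $X\to\mathbb R$ containing constants, closed under addition, composition with $\mathrm{Bic}(\mathbb R)$, and uniform limits. $\bigvee F_0$ = least Bishop topology containing $F_0$. A Bishop morphism $(X,F)\to(Y,G)$ is a function $h$ with $g\circ h\in F$ for all $g\in G$; set $\mathrm{Mor}$. A direct spectrum: a direct family with Bishop topologies $F_i$ on $\lambda_0(i)$ such that each $\lambda^{\preccurlyeq}_{ij}\in\mathrm{Mor}(\mathcal F_i,\mathcal F_j)$. A direct spectrum-map $\Psi$ is a family of functions $\Psi_i:\lambda_0(i)\to\mu_0(i)$ with $\Psi_j\circ\lambda^{\preccurlyeq}_{ij}=\mu^{\preccurlyeq}_{ij}\circ\Psi_i$ for $i\preccurlyeq j$; it is continuous if each $\Psi_i\in\mathrm{Mor}(\mathcal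 F_i,\mathcal G_i)$. Direct limit: $\sum^{\preccurlyeq}\lambda_0(i)$ = pairs $(i,x)$, with $(i,x)=(j,y)$ iff there is $k\succcurlyeq i,j$ with $\lambda^{\preccurlyeq}_{ik}(x)=\lambda^{\preccurlyeq}_{jk}(y)$. $\prod^{\succcurlyeq}F_i$ = dependent assignments $\Theta$ with $\Theta_i\in F_i$ and $\Theta_i=\Theta_j\circ\lambda^{\preccurlyeq}_{ij}$ for $i\preccurlyeq j$. $\underset{\to}{\mathrm{Lim}}\,\lambda_0(i)$ has elements $\mathrm{eql}_0(i,x)$ with $\mathrm{eql}_0(i,x)=\mathrm{eql}_0(j,y)$ iff $(i,x)=(j,y)$ in $\sum^{\preccurlyeq}$; $\mathrm{eql}_0f_\Theta(\mathrm{eql}_0(i,x)):=\Theta_i(x)$; $\underset{\to}{\mathrm{Lim}}\,\mathcal F_i=(\underset{\to}{\mathrm{Lim}}\,\lambda_0(i),\bigvee\{\mathrm{eql}_0f_\Theta:\Theta\in\prod^{\succcurlyeq}F_i\})$; $\mathrm{eql}^{\Lambda^{\preccurlyeq}}_i(x)=\mathrm{eql}_0(i,x)$. The same constructions apply to $S(M^{\preccurlyeq})$. -}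

module Defs where

open import Data.Integer as ℤ using (ℤ)
import Data.Integer.Properties as ℤ
open import Data.Nat as ℕ using (ℕ; zero; suc)
import Data.Nat.Properties as ℕ
open import Data.Nat.Solver using (module +-*-Solver)
open import Data.Product using (Σ; ∃; _×_; _,_)
open import Data.Sum using (inj₁; inj₂)
open import Data.Rational as ℚ using (ℚ; mkℚ; 0ℚ)
import Data.Rational.Properties as ℚ
import Data.Rational.Solver as ℚ
import Data.Rational.Unnormalised as ℚᵘ
import Data.Rational.Unnormalised.Properties as ℚᵘ
open import Function.Bundles using (Func; _⟶ₛ_; _⟨$⟩_)
import Function.Construct.Composition as Composition
open import Function.Definitions using (Injective)
import Function.Relation.Binary.Setoid.Equality as FunctionEquality
open import Level using (Level; _⊔_; 0ℓ) renaming (suc to lsuc)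
open import Relation.Binary using (Setoid; Preorder; Rel; IsEquivalence)
import Relation.Binary.Construct.On as On
import Relation.Binary.Reasoning.Setoid as ≈-Reasoning
open import Relation.Binary.PropositionalEquality
  using (_≡_; refl; sym; trans; cong; cong₂; subst; subst₂)
open import Relation.Nullary using (yes; no; contradiction)
open import Relation.Unary using (Pred; _∈_)

private variable
  c ℓ₁ ℓ₂ a ℓ b m p q : Level

infixr 9 _∘_
_∘_ : {X : Setoid a ℓ} {Y : Setoid b m} {Z : Setoid p q} →
      Y ⟶ₛ Z → X ⟶ₛ Y → X ⟶ₛ Z
g ∘ f = Composition.function f g

-- Bishop's real numbers: regular sequences of rationals, x₁, x₂, …,
-- with |xₘ - xₙ| ≤ 1/m + 1/n.  Since ℕ starts at 0, indices are
-- shifted by one: `seq x n` is the term with index suc n.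

1/suc : ℕ → ℚ
1/suc n = ℤ.+ 1 ℚ./ suc n

-- Eta is disabled on ℝ and _≈ʳ_ only so that unification treats real numbers
-- and their equalities as units instead of unfolding rational arithmetic.
record ℝ : Set where
  no-eta-equality
  constructor mkℝ
  field
    seq     : ℕ → ℚ
    regular : ∀ k n → ℚ.∣ seq k ℚ.- seq n ∣ ℚ.≤ 1/suc k ℚ.+ 1/suc n

open ℝ public

infix 4 _≈ʳ_ _≤_ _<_

record _≈ʳ_ (x y : ℝ) : Set where
  no-eta-equality
  field
    close : ∀ n → ℚ.∣ seq x n ℚ.- seq y n ∣ ℚ.≤ 1/suc n ℚ.+ 1/suc n

open _≈ʳ_ public

-- At shifted indices, n ↦ 1 + 2n is the doubling n ↦ 2n used by Bishop to
-- add regular sequences: suc (double n) = 2 * suc n.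
double : ℕ → ℕ
double n = suc (n ℕ.+ n)

private
  toℚᵘ-1/suc : ∀ n → ℚ.toℚᵘ (1/suc n) ℚᵘ.≃ ℚᵘ.mkℚᵘ (ℤ.+ 1) n
  toℚᵘ-1/suc n = ℚ.toℚᵘ-fromℚᵘ (ℚᵘ.mkℚᵘ (ℤ.+ 1) n)

  1/suc-double : ∀ n → 1/suc (double n) ℚ.+ 1/suc (double n) ≡ 1/suc n
  1/suc-double n = ℚ.toℚᵘ-injective (begin-equality
    ℚ.toℚᵘ (1/suc (double n) ℚ.+ 1/suc (double n))
      ≃⟨ ℚ.toℚᵘ-homo-+ (1/suc (double n)) (1/suc (double n)) ⟩
    ℚ.toℚᵘ (1/suc (double n)) ℚᵘ.+ ℚ.toℚᵘ (1/suc (double n))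
      ≃⟨ ℚᵘ.+-cong (toℚᵘ-1/suc (double n)) (toℚᵘ-1/suc (double n)) ⟩
    ℚᵘ.mkℚᵘ (ℤ.+ 1) (double n) ℚᵘ.+ ℚᵘ.mkℚᵘ (ℤ.+ 1) (double n)
      ≃⟨ ℚᵘ.*≡* (cong ℤ.+_ (solve 1 (λ k →
           ((con 2 :+ (k :+ k) :+ con 0) :+ (con 2 :+ (k :+ k) :+ con 0))
             :* (con 1 :+ k)
           := (con 2 :+ (k :+ k)) :* (con 2 :+ (k :+ k)) :+ con 0) refl n)) ⟩
    ℚᵘ.mkℚᵘ (ℤ.+ 1) n
      ≃⟨ toℚᵘ-1/suc n ⟨
    ℚ.toℚᵘ (1/suc n) ∎)
    where
    open ℚᵘ.≤-Reasoning
    open +-*-Solver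

  1/suc-nonneg : ∀ n → 0ℚ ℚ.≤ 1/suc n
  1/suc-nonneg n = ℚ.nonNegative⁻¹ (1/suc n) {{ℚ.normalize-nonNeg 1 (suc n)}}

  1/suc-small : ∀ s → 0ℚ ℚ.< s → ∃ λ n → 1/suc n ℚ.< s
  1/suc-small (mkℚ (ℤ.+ zero) d-1 _) (ℚ.*<* (ℤ.+<+ ()))
  1/suc-small (mkℚ ℤ.-[1+ k ] d-1 _) (ℚ.*<* ())
  1/suc-small s@(mkℚ (ℤ.+ suc k) d-1 _) _ = suc d-1 , ℚ.toℚᵘ-cancel-<
    (ℚᵘ.<-respˡ-≃ (ℚᵘ.≃-sym (toℚᵘ-1/suc (suc d-1)))
      (ℚᵘ.*<* (ℤ.+<+ (ℕ.s≤s (ℕ.≤-trans (ℕ.≤-reflexive (cong suc (ℕ.+-identityʳ d-1)))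
        (ℕ.m≤m+n (suc d-1) _))))))

  archimedean : ∀ s t → (∀ n → s ℚ.≤ t ℚ.+ 1/suc n) → s ℚ.≤ t
  archimedean s t h with s ℚ.≤? t
  ... | yes s≤t = s≤t
  ... | no  s≰t with 1/suc-small (s ℚ.- t)
                       (subst (ℚ._< s ℚ.- t) (ℚ.+-inverseʳ t)
                         (ℚ.+-monoˡ-< (ℚ.- t) (ℚ.≰⇒> s≰t)))
  ...   | n , 1/n<s-t = contradiction
          (ℚ.≤-<-trans (h n)
            (subst (t ℚ.+ 1/suc n ℚ.<_)
              (solve 2 (λ s t → t :+ (s :- t) := s) refl s t)
              (ℚ.+-monoʳ-< t 1/n<s-t)))
          (ℚ.<-irrefl refl)
    where open ℚ.+-*-Solver

  ∣s-t∣≡∣t-s∣ : ∀ s t → ℚ.∣ s ℚ.- t ∣ ≡ ℚ.∣ t ℚ.- s ∣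
  ∣s-t∣≡∣t-s∣ s t = subst (λ u → ℚ.∣ u ∣ ≡ ℚ.∣ t ℚ.- s ∣)
    (solve 2 (λ s t → :- (t :- s) := s :- t) refl s t) (ℚ.∣-p∣≡∣p∣ (t ℚ.- s))
    where open ℚ.+-*-Solver

  triangle : ∀ s t u → ℚ.∣ s ℚ.- u ∣ ℚ.≤ ℚ.∣ s ℚ.- t ∣ ℚ.+ ℚ.∣ t ℚ.- u ∣
  triangle s t u = subst (λ v → ℚ.∣ v ∣ ℚ.≤ ℚ.∣ s ℚ.- t ∣ ℚ.+ ℚ.∣ t ℚ.- u ∣)
    (solve 3 (λ s t u → (s :- t) :+ (t :- u) := s :- u) refl s t u)
    (ℚ.∣p+q∣≤∣p∣+∣q∣ (s ℚ.- t) (t ℚ.- u))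
    where open ℚ.+-*-Solver

  +-distance : ∀ {δ ε} s t s′ t′ →
               ℚ.∣ s ℚ.- s′ ∣ ℚ.≤ δ → ℚ.∣ t ℚ.- t′ ∣ ℚ.≤ ε →
               ℚ.∣ (s ℚ.+ t) ℚ.- (s′ ℚ.+ t′) ∣ ℚ.≤ δ ℚ.+ ε
  +-distance {δ} {ε} s t s′ t′ h k =
    subst (λ v → ℚ.∣ v ∣ ℚ.≤ δ ℚ.+ ε)
      (solve 4 (λ s t s′ t′ →
         (s :- s′) :+ (t :- t′) := (s :+ t) :- (s′ :+ t′)) refl s t s′ t′)
      (ℚ.≤-trans (ℚ.∣p+q∣≤∣p∣+∣q∣ (s ℚ.- s′) (t ℚ.- t′)) (ℚ.+-mono-≤ h k))
    where open ℚ.+-*-Solver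

  neg-distance : ∀ s t → ℚ.∣ (ℚ.- s) ℚ.- (ℚ.- t) ∣ ≡ ℚ.∣ s ℚ.- t ∣
  neg-distance s t = subst (λ u → ℚ.∣ u ∣ ≡ ℚ.∣ s ℚ.- t ∣)
    (solve 2 (λ s t → :- (s :- t) := (:- s) :- (:- t)) refl s t)
    (ℚ.∣-p∣≡∣p∣ (s ℚ.- t))
    where open ℚ.+-*-Solver

  ∣s∣-∣t∣≤∣s-t∣ : ∀ s t → ℚ.∣ s ∣ ℚ.- ℚ.∣ t ∣ ℚ.≤ ℚ.∣ s ℚ.- t ∣
  ∣s∣-∣t∣≤∣s-t∣ s t = subst (ℚ.∣ s ∣ ℚ.- ℚ.∣ t ∣ ℚ.≤_)
    (solve 2 (λ u v → (u :+ v) :- v := u) refl ℚ.∣ s ℚ.- t ∣ ℚ.∣ t ∣)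
    (ℚ.+-monoˡ-≤ (ℚ.- ℚ.∣ t ∣)
      (subst (λ v → ℚ.∣ v ∣ ℚ.≤ ℚ.∣ s ℚ.- t ∣ ℚ.+ ℚ.∣ t ∣)
        (solve 2 (λ s t → (s :- t) :+ t := s) refl s t)
        (ℚ.∣p+q∣≤∣p∣+∣q∣ (s ℚ.- t) t)))
    where open ℚ.+-*-Solver

  abs-distance : ∀ s t → ℚ.∣ ℚ.∣ s ∣ ℚ.- ℚ.∣ t ∣ ∣ ℚ.≤ ℚ.∣ s ℚ.- t ∣
  abs-distance s t with ℚ.∣p∣≡p∨∣p∣≡-p (ℚ.∣ s ∣ ℚ.- ℚ.∣ t ∣)
  ... | inj₁ e = subst (ℚ._≤ ℚ.∣ s ℚ.- t ∣) (sym e) (∣s∣-∣t∣≤∣s-t∣ s t)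
  ... | inj₂ e = subst₂ ℚ._≤_
      (trans (solve 2 (λ u v → v :- u := :- (u :- v)) refl ℚ.∣ s ∣ ℚ.∣ t ∣)
        (sym e))
      (∣s-t∣≡∣t-s∣ t s) (∣s∣-∣t∣≤∣s-t∣ t s)
    where open ℚ.+-*-Solver

  collect : ∀ N L {K₀ K₁ K₂} → 0ℚ ℚ.≤ L →
            K₁ ℚ.+ K₁ ≡ K₀ → K₂ ℚ.+ K₂ ≡ K₁ → L ℚ.+ L ≡ K₂ →
            (N ℚ.+ L) ℚ.+ ((L ℚ.+ L) ℚ.+ ((L ℚ.+ L) ℚ.+ (L ℚ.+ N)))
              ℚ.≤ (N ℚ.+ N) ℚ.+ K₀
  collect N L 0≤L refl refl refl = begin
    S                   ≡⟨ ℚ.+-identityʳ S ⟨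
    S ℚ.+ 0ℚ            ≤⟨ ℚ.+-monoʳ-≤ S (ℚ.+-mono-≤ 0≤L 0≤L) ⟩
    S ℚ.+ (L ℚ.+ L)
      ≡⟨ solve 2 (λ N L →
           ((N :+ L) :+ ((L :+ L) :+ ((L :+ L) :+ (L :+ N)))) :+ (L :+ L)
           := (N :+ N) :+ (((L :+ L) :+ (L :+ L)) :+ ((L :+ L) :+ (L :+ L))))
           refl N L ⟩
    (N ℚ.+ N) ℚ.+ (((L ℚ.+ L) ℚ.+ (L ℚ.+ L)) ℚ.+ ((L ℚ.+ L) ℚ.+ (L ℚ.+ L))) ∎
    where
    open ℚ.≤-Reasoning
    open ℚ.+-*-Solver
    S = (N ℚ.+ L) ℚ.+ ((L ℚ.+ L) ℚ.+ ((L ℚ.+ L) ℚ.+ (L ℚ.+ N)))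

  ≈ʳ-trans : ∀ {x y z} → x ≈ʳ y → y ≈ʳ z → x ≈ʳ z
  close (≈ʳ-trans {x} {y} {z} x≈y y≈z) n =
    archimedean ℚ.∣ seq x n ℚ.- seq z n ∣ (1/suc n ℚ.+ 1/suc n) λ k →
      chain n (double (double (double k))) (1/suc k)
      (collect (1/suc n) (1/suc (double (double (double k)))) (1/suc-nonneg (double (double (double k))))
        (1/suc-double k) (1/suc-double (double k))
        (1/suc-double (double (double k))))
    where
    open ℚ.≤-Reasoning
    chain : ∀ n l K →
      (1/suc n ℚ.+ 1/suc l) ℚ.+ ((1/suc l ℚ.+ 1/suc l) ℚ.+
        ((1/suc l ℚ.+ 1/suc l) ℚ.+ (1/suc l ℚ.+ 1/suc n)))
        ℚ.≤ (1/suc n ℚ.+ 1/suc n) ℚ.+ K →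
      ℚ.∣ seq x n ℚ.- seq z n ∣ ℚ.≤ (1/suc n ℚ.+ 1/suc n) ℚ.+ K
    chain n l K h = begin
      ℚ.∣ xn ℚ.- zn ∣
        ≤⟨ triangle xn xl zn ⟩
      ℚ.∣ xn ℚ.- xl ∣ ℚ.+ ℚ.∣ xl ℚ.- zn ∣
        ≤⟨ ℚ.+-monoʳ-≤ ℚ.∣ xn ℚ.- xl ∣ (triangle xl yl zn) ⟩
      ℚ.∣ xn ℚ.- xl ∣ ℚ.+ (ℚ.∣ xl ℚ.- yl ∣ ℚ.+ ℚ.∣ yl ℚ.- zn ∣)
        ≤⟨ ℚ.+-monoʳ-≤ ℚ.∣ xn ℚ.- xl ∣
             (ℚ.+-monoʳ-≤ ℚ.∣ xl ℚ.- yl ∣ (triangle yl zl zn)) ⟩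
      ℚ.∣ xn ℚ.- xl ∣ ℚ.+
        (ℚ.∣ xl ℚ.- yl ∣ ℚ.+ (ℚ.∣ yl ℚ.- zl ∣ ℚ.+ ℚ.∣ zl ℚ.- zn ∣))
        ≤⟨ ℚ.+-mono-≤ (regular x n l) (ℚ.+-mono-≤ (close x≈y l)
             (ℚ.+-mono-≤ (close y≈z l) (regular z l n))) ⟩
      (1/suc n ℚ.+ 1/suc l) ℚ.+ ((1/suc l ℚ.+ 1/suc l) ℚ.+
        ((1/suc l ℚ.+ 1/suc l) ℚ.+ (1/suc l ℚ.+ 1/suc n)))
        ≤⟨ h ⟩
      (1/suc n ℚ.+ 1/suc n) ℚ.+ K ∎
      where
      xn = seq x n
      zn = seq z n
      xl = seq x l
      yl = seq y l
      zl = seq z l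

  ≈ʳ-refl : ∀ {x} → x ≈ʳ x
  close (≈ʳ-refl {x}) n = subst (ℚ._≤ 1/suc n ℚ.+ 1/suc n)
    (cong ℚ.∣_∣ (sym (ℚ.+-inverseʳ (seq x n))))
    (ℚ.+-mono-≤ (1/suc-nonneg n) (1/suc-nonneg n))

  ≈ʳ-sym : ∀ {x y} → x ≈ʳ y → y ≈ʳ x
  close (≈ʳ-sym {x} {y} x≈y) n = subst (ℚ._≤ 1/suc n ℚ.+ 1/suc n)
    (∣s-t∣≡∣t-s∣ (seq x n) (seq y n)) (close x≈y n)

ℝ-setoid : Setoid 0ℓ 0ℓ
ℝ-setoid = record
  { Carrier       = ℝ
  ; _≈_           = _≈ʳ_
  ; isEquivalence = record { refl = ≈ʳ-refl ; sym = ≈ʳ-sym ; trans = ≈ʳ-trans }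
  }

fromℚ : ℚ → ℝ
fromℚ s = mkℝ (λ _ → s) λ k n → subst (ℚ._≤ 1/suc k ℚ.+ 1/suc n)
  (cong ℚ.∣_∣ (sym (ℚ.+-inverseʳ s)))
  (ℚ.+-mono-≤ (1/suc-nonneg k) (1/suc-nonneg n))

fromℕ : ℕ → ℝ
fromℕ n = fromℚ (ℤ.+ n ℚ./ 1)

0ℝ : ℝ
0ℝ = fromℚ 0ℚ

infixl 6 _+_ _-_
infix  8 -_

_+_ : ℝ → ℝ → ℝ
seq     (x + y) n   = seq x (double n) ℚ.+ seq y (double n)
regular (x + y) k n = ℚ.≤-trans
  (+-distance (seq x (double k)) (seq y (double k))
              (seq x (double n)) (seq y (double n))
              (regular x (double k) (double n))
              (regular y (double k) (double n)))
  (ℚ.≤-reflexive (begin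
    (K ℚ.+ N) ℚ.+ (K ℚ.+ N)
      ≡⟨ solve 2 (λ K N → (K :+ N) :+ (K :+ N) := (K :+ K) :+ (N :+ N))
           refl K N ⟩
    (K ℚ.+ K) ℚ.+ (N ℚ.+ N)
      ≡⟨ cong₂ ℚ._+_ (1/suc-double k) (1/suc-double n) ⟩
    1/suc k ℚ.+ 1/suc n ∎))
  where
  open ℚ.+-*-Solver
  open Relation.Binary.PropositionalEquality.≡-Reasoning
  K = 1/suc (double k)
  N = 1/suc (double n)

-_ : ℝ → ℝ
seq     (- x) n   = ℚ.- seq x n
regular (- x) k n = subst (ℚ._≤ 1/suc k ℚ.+ 1/suc n)
  (sym (neg-distance (seq x k) (seq x n))) (regular x k n)

_-_ : ℝ → ℝ → ℝ
x - y = x + (- y)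

∣_∣ : ℝ → ℝ
seq     ∣ x ∣ n   = ℚ.∣ seq x n ∣
regular ∣ x ∣ k n = ℚ.≤-trans (abs-distance (seq x k) (seq x n)) (regular x k n)

NonNegative Positive : Pred ℝ 0ℓ
NonNegative x = ∀ n → ℚ.- 1/suc n ℚ.≤ seq x n
Positive    x = ∃ λ n → 1/suc n ℚ.< seq x n

_≤_ _<_ : Rel ℝ 0ℓ
x ≤ y = NonNegative (y - x)
x < y = Positive (y - x)

+-cong : ∀ {x x′ y y′} → x ≈ʳ x′ → y ≈ʳ y′ → x + y ≈ʳ x′ + y′
close (+-cong {x} {x′} {y} {y′} x≈x′ y≈y′) n = ℚ.≤-trans
  (+-distance (seq x (double n)) (seq y (double n))
              (seq x′ (double n)) (seq y′ (double n))
              (close x≈x′ (double n)) (close y≈y′ (double n)))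
  (ℚ.≤-reflexive (cong₂ ℚ._+_ (1/suc-double n) (1/suc-double n)))

module _ {X : Setoid a ℓ} where

  constᶠ : ℝ → X ⟶ₛ ℝ-setoid
  constᶠ s = record { to = λ _ → s ; cong = λ _ → Setoid.refl ℝ-setoid }

  infixl 6 _+ᶠ_
  _+ᶠ_ : X ⟶ₛ ℝ-setoid → X ⟶ₛ ℝ-setoid → X ⟶ₛ ℝ-setoid
  f +ᶠ g = record
    { to   = λ x → (f ⟨$⟩ x) + (g ⟨$⟩ x)
    ; cong = λ x≈y → +-cong (Func.cong f x≈y) (Func.cong g x≈y)
    }

  WithinUniformly : ℝ → X ⟶ₛ ℝ-setoid → X ⟶ₛ ℝ-setoid → Set a
  WithinUniformly ε f g = ∀ x → ∣ (f ⟨$⟩ x) - (g ⟨$⟩ x) ∣ ≤ ε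

-- Bic(ℝ).  A record, so that φ can be inferred from a proof of Bic φ.
record Bic (φ : ℝ-setoid ⟶ₛ ℝ-setoid) : Set where
  field
    uniformlyContinuous : ∀ n ε → 0ℝ < ε → ∃ λ δ → 0ℝ < δ ×
      (∀ x y → - fromℕ n ≤ x → x ≤ fromℕ n → - fromℕ n ≤ y → y ≤ fromℕ n →
       ∣ x - y ∣ < δ → ∣ (φ ⟨$⟩ x) - (φ ⟨$⟩ y) ∣ ≤ ε)

record IsBishopTopology (X : Setoid a ℓ) (F : Pred (X ⟶ₛ ℝ-setoid) p)
       : Set (a ⊔ ℓ ⊔ p) where
  open FunctionEquality X ℝ-setoid using (_≈_)
  field
    resp-≈         : ∀ {f g} → f ≈ g → f ∈ F → g ∈ F
    const-closed   : ∀ s → constᶠ s ∈ F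
    +-closed       : ∀ {f g} → f ∈ F → g ∈ F → f +ᶠ g ∈ F
    Bic-closed     : ∀ {φ f} → φ ∈ Bic → f ∈ F → φ ∘ f ∈ F
    uniform-closed : ∀ {f} →
                     (∀ ε → 0ℝ < ε → ∃ λ g → g ∈ F × WithinUniformly ε f g) →
                     f ∈ F

record BishopSpace a ℓ p : Set (lsuc (a ⊔ ℓ ⊔ p)) where
  field
    set              : Setoid a ℓ
    F                : Pred (set ⟶ₛ ℝ-setoid) p
    isBishopTopology : IsBishopTopology set F

module _ {X : Setoid a ℓ} where

  open FunctionEquality X ℝ-setoid using (_≈_)

  -- The least Bishop topology containing F₀, generated inductively; that it
  -- is one, and is least, is ⋁-isBishopTopology and ⋁-least.
  data ⋁ (F₀ : Pred (X ⟶ₛ ℝ-setoid) p) : Pred (X ⟶ₛ ℝ-setoid) (a ⊔ ℓ ⊔ p) where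
    base    : ∀ {f} → f ∈ F₀ → f ∈ ⋁ F₀
    resp    : ∀ {f g} → f ≈ g → f ∈ ⋁ F₀ → g ∈ ⋁ F₀
    const   : ∀ s → constᶠ s ∈ ⋁ F₀
    add     : ∀ {f g} → f ∈ ⋁ F₀ → g ∈ ⋁ F₀ → f +ᶠ g ∈ ⋁ F₀
    bic     : ∀ {φ f} → φ ∈ Bic → f ∈ ⋁ F₀ → φ ∘ f ∈ ⋁ F₀
    uniform : ∀ {f} →
              (∀ ε → 0ℝ < ε → ∃ λ g → g ∈ ⋁ F₀ × WithinUniformly ε f g) →
              f ∈ ⋁ F₀

  ⋁-isBishopTopology : (F₀ : Pred (X ⟶ₛ ℝ-setoid) p) →
                       IsBishopTopology X (⋁ F₀)
  ⋁-isBishopTopology F₀ = record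
    { resp-≈         = resp
    ; const-closed   = const
    ; +-closed       = add
    ; Bic-closed     = bic
    ; uniform-closed = uniform
    }

  ⋁-least : {F₀ : Pred (X ⟶ₛ ℝ-setoid) p} {F : Pred (X ⟶ₛ ℝ-setoid) q} →
            IsBishopTopology X F → (∀ {f} → f ∈ F₀ → f ∈ F) →
            ∀ {f} → f ∈ ⋁ F₀ → f ∈ F
  ⋁-least {F₀ = F₀} {F} isTop F₀⊆F = go
    where
    open IsBishopTopology isTop
    go : ∀ {f} → f ∈ ⋁ F₀ → f ∈ F
    go (base f∈F₀)   = F₀⊆F f∈F₀
    go (resp f≈g f∈) = resp-≈ f≈g (go f∈)
    go (const s)     = const-closed s
    go (add f∈ g∈)   = +-closed (go f∈) (go g∈)
    go (bic φ∈ f∈)   = Bic-closed φ∈ (go f∈)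
    go (uniform h)   = uniform-closed λ ε 0<ε → let g , g∈ , close = h ε 0<ε in
                         g , go g∈ , close

Mor : (𝓕 : BishopSpace a ℓ p) (𝓖 : BishopSpace b m q) →
      Pred (BishopSpace.set 𝓕 ⟶ₛ BishopSpace.set 𝓖) (b ⊔ m ⊔ p ⊔ q)
Mor 𝓕 𝓖 h = ∀ g → g ∈ BishopSpace.F 𝓖 → g ∘ h ∈ BishopSpace.F 𝓕

IsEmbedding : {X : Setoid a ℓ} {Y : Setoid b m} → Pred (X ⟶ₛ Y) (a ⊔ ℓ ⊔ m)
IsEmbedding {X = X} {Y} f = Injective (Setoid._≈_ X) (Setoid._≈_ Y) (f ⟨$⟩_)

record DirectedSet c ℓ₁ ℓ₂ : Set (lsuc (c ⊔ ℓ₁ ⊔ ℓ₂)) where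
  field
    preorder : Preorder c ℓ₁ ℓ₂
  open Preorder preorder public
    using (Carrier; _≈_)
    renaming (_≲_ to _≼_; refl to ≼-refl; trans to ≼-trans)
  field
    upperBound : ∀ i j → ∃ λ k → i ≼ k × j ≼ k

-- The laws quantify over all proofs of i ≼ j, so that the transports do not
-- depend on the proof: by λ≼-id and λ≼-∘, any two proofs give equal maps.
-- In particular, equal indices have isomorphic sets via λ≼, so that λ₀
-- respects the equality of the index set.
record DirectFamily (I : DirectedSet c ℓ₁ ℓ₂) a ℓ
       : Set (c ⊔ ℓ₂ ⊔ lsuc (a ⊔ ℓ)) where
  open DirectedSet I using (Carrier; _≼_)
  field
    λ₀ : Carrier → Setoid a ℓ
    λ≼ : ∀ {i j} → i ≼ j → λ₀ i ⟶ₛ λ₀ j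

  module λ₀ i = Setoid (λ₀ i)

  field
    λ≼-id : ∀ {i} (i≼i : i ≼ i) x → λ₀._≈_ i (λ≼ i≼i ⟨$⟩ x) x
    λ≼-∘  : ∀ {i j k} (i≼j : i ≼ j) (j≼k : j ≼ k) (i≼k : i ≼ k) x →
            λ₀._≈_ k (λ≼ i≼k ⟨$⟩ x) (λ≼ j≼k ⟨$⟩ (λ≼ i≼j ⟨$⟩ x))

record DirectSpectrum (I : DirectedSet c ℓ₁ ℓ₂) a ℓ p
       : Set (c ⊔ ℓ₂ ⊔ lsuc (a ⊔ ℓ ⊔ p)) where
  open DirectedSet I using (Carrier; _≼_)
  field
    family           : DirectFamily I a ℓ
  open DirectFamily family public
  field
    F                : ∀ i → Pred (λ₀ i ⟶ₛ ℝ-setoid) p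
    isBishopTopology : ∀ i → IsBishopTopology (λ₀ i) (F i)

  𝓕 : Carrier → BishopSpace a ℓ p
  𝓕 i = record { set = λ₀ i ; F = F i ; isBishopTopology = isBishopTopology i }

  field
    λ≼-Mor : ∀ {i j} (i≼j : i ≼ j) → λ≼ i≼j ∈ Mor (𝓕 i) (𝓕 j)

module _ {I : DirectedSet c ℓ₁ ℓ₂} where

  open DirectedSet I using (Carrier; _≼_)

  record SpectrumMap (S : DirectSpectrum I a ℓ p) (T : DirectSpectrum I b m q)
         : Set (c ⊔ ℓ₂ ⊔ a ⊔ ℓ ⊔ b ⊔ m) where
    private
      module S = DirectSpectrum S
      module T = DirectSpectrum T
    field
      Ψ       : ∀ i → S.λ₀ i ⟶ₛ T.λ₀ i
      natural : ∀ {i j} (i≼j : i ≼ j) →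
                let open FunctionEquality (S.λ₀ i) (T.λ₀ j) in
                Ψ j ∘ S.λ≼ i≼j ≈ T.λ≼ i≼j ∘ Ψ i

  IsContinuous : {S : DirectSpectrum I a ℓ p} {T : DirectSpectrum I b m q} →
                 SpectrumMap S T → Set (c ⊔ b ⊔ m ⊔ p ⊔ q)
  IsContinuous {S = S} {T} Ψ =
    ∀ i → SpectrumMap.Ψ Ψ i ∈ Mor (DirectSpectrum.𝓕 S i) (DirectSpectrum.𝓕 T i)

module _ {I : DirectedSet c ℓ₁ ℓ₂} (S : DirectSpectrum I a ℓ p) where

  open DirectedSet I
  open DirectSpectrum S

  ∑≼ : Setoid (c ⊔ a) (c ⊔ ℓ₂ ⊔ ℓ)
  ∑≼ = record
    { Carrier       = ∃ λ i → λ₀.Carrier i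
    ; _≈_           = λ (i , x) (j , y) →
        ∃ λ k → Σ (i ≼ k) λ i≼k → Σ (j ≼ k) λ j≼k →
        λ₀._≈_ k (λ≼ i≼k ⟨$⟩ x) (λ≼ j≼k ⟨$⟩ y)
    ; isEquivalence = record
      { refl  = λ {(i , x)} → i , ≼-refl , ≼-refl , λ₀.refl i
      ; sym   = λ (k , i≼k , j≼k , e) → k , j≼k , i≼k , λ₀.sym k e
      ; trans = λ {(i , x)} {(j , y)} {(l , z)}
                  (k , i≼k , j≼k , e) (k′ , j≼k′ , l≼k′ , e′) →
          let n , k≼n , k′≼n = upperBound k k′
              i≼n = ≼-trans i≼k k≼n
              j≼n = ≼-trans j≼k k≼n
              l≼n = ≼-trans l≼k′ k′≼n
              open ≈-Reasoning (λ₀ n)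
          in n , i≼n , l≼n , (begin
            λ≼ i≼n ⟨$⟩ x               ≈⟨ λ≼-∘ i≼k k≼n i≼n x ⟩
            λ≼ k≼n ⟨$⟩ (λ≼ i≼k ⟨$⟩ x)   ≈⟨ Func.cong (λ≼ k≼n) e ⟩
            λ≼ k≼n ⟨$⟩ (λ≼ j≼k ⟨$⟩ y)   ≈⟨ λ≼-∘ j≼k k≼n j≼n y ⟨
            λ≼ j≼n ⟨$⟩ y               ≈⟨ λ≼-∘ j≼k′ k′≼n j≼n y ⟩
            λ≼ k′≼n ⟨$⟩ (λ≼ j≼k′ ⟨$⟩ y) ≈⟨ Func.cong (λ≼ k′≼n) e′ ⟩
            λ≼ k′≼n ⟨$⟩ (λ≼ l≼k′ ⟨$⟩ z) ≈⟨ λ≼-∘ l≼k′ k′≼n l≼n z ⟨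
            λ≼ l≼n ⟨$⟩ z               ∎)
      }
    }

  -- The elements eql₀(i,x), kept apart from the pairs (i,x) and equal exactly
  -- when the pairs are equal in ∑≼.
  record Lim₀ : Set (c ⊔ a) where
    constructor eql₀
    field
      pair : Setoid.Carrier ∑≼

  Limₛ : Setoid (c ⊔ a) (c ⊔ ℓ₂ ⊔ ℓ)
  Limₛ = On.setoid ∑≼ Lim₀.pair

  eql : ∀ i → λ₀ i ⟶ₛ Limₛ
  eql i = record
    { to   = λ x → eql₀ (i , x)
    ; cong = λ x≈y → i , ≼-refl , ≼-refl , Func.cong (λ≼ ≼-refl) x≈y
    }

  record ∏≽F : Set (c ⊔ ℓ₂ ⊔ a ⊔ ℓ ⊔ p) where
    field
      Θ          : ∀ i → λ₀ i ⟶ₛ ℝ-setoid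
      Θ∈F        : ∀ i → Θ i ∈ F i
      compatible : ∀ {i j} (i≼j : i ≼ j) →
                   let open FunctionEquality (λ₀ i) ℝ-setoid renaming (_≈_ to _≈ᶠ_)
                   in Θ i ≈ᶠ Θ j ∘ λ≼ i≼j

  eql₀f : ∏≽F → Limₛ ⟶ₛ ℝ-setoid
  eql₀f θ = record
    { to   = λ (eql₀ (i , x)) → Θ i ⟨$⟩ x
    ; cong = λ {(eql₀ (i , x))} {(eql₀ (j , y))} (k , i≼k , j≼k , e) →
        let open ≈-Reasoning ℝ-setoid in begin
        Θ i ⟨$⟩ x               ≈⟨ compatible i≼k x ⟩
        Θ k ⟨$⟩ (λ≼ i≼k ⟨$⟩ x)   ≈⟨ Func.cong (Θ k) e ⟩
        Θ k ⟨$⟩ (λ≼ j≼k ⟨$⟩ y)   ≈⟨ compatible j≼k y ⟨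
        Θ j ⟨$⟩ y               ∎
    }
    where open ∏≽F θ

  eql₀f-image : Pred (Limₛ ⟶ₛ ℝ-setoid) (c ⊔ ℓ₂ ⊔ a ⊔ ℓ ⊔ p)
  eql₀f-image f = ∃ λ (θ : ∏≽F) → f ≈ᶠ eql₀f θ
    where open FunctionEquality Limₛ ℝ-setoid renaming (_≈_ to _≈ᶠ_)

  Lim : BishopSpace (c ⊔ a) (c ⊔ ℓ₂ ⊔ ℓ) (c ⊔ ℓ₂ ⊔ a ⊔ ℓ ⊔ p)
  Lim = record
    { set              = Limₛ
    ; F                = ⋁ eql₀f-image
    ; isBishopTopology = ⋁-isBishopTopology eql₀f-image
    }

{-# OPTIONS --safe #-}
module Submission where

open import Defs
open import Data.Product using (Σ; ∃!; _×_; _,_)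
open import Function.Bundles using (Func; _⟶ₛ_; _⟨$⟩_)
open import Level using (Level)
open import Relation.Binary using (Setoid)
open import Relation.Unary using (_∈_; Pred)
import Function.Relation.Binary.Setoid.Equality as FunctionEquality
import Relation.Binary.Reasoning.Setoid as ≈-Reasoning

private variable
  c ℓ₁ ℓ₂ a ℓ b m p q : Level

-- Every element of the limit is some `eql₀ (i , x)`, so the required equations leave only
-- `eql₀ (i , x) ↦ eql₀ (i , Ψ i x)`. Naturality makes this well defined: a stage `k` where two
-- representatives agree is also one where their images agree. Run backwards, with injectivity of
-- `Ψ k`, the same argument gives the embedding claim. For continuity, the functions whose composite
-- with the limit map is continuous form a Bishop topology (`pullback-isBishopTopology`), so only
-- generators need checking; there, compatible families pull back along `Ψ` (`∏≽F-pullback`).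

pullback-isBishopTopology :
  {X : Setoid a ℓ} {Y : Setoid b m} {F : Pred (X ⟶ₛ ℝ-setoid) p} →
  IsBishopTopology X F → (h : X ⟶ₛ Y) →
  IsBishopTopology Y (λ g → g ∘ h ∈ F)
pullback-isBishopTopology isTop h = record
  { resp-≈         = λ f≈g → resp-≈ λ x → f≈g (h ⟨$⟩ x)
  ; const-closed   = λ s → resp-≈ (λ _ → Setoid.refl ℝ-setoid) (const-closed s)
  ; +-closed       = λ f∈ g∈ → resp-≈ (λ _ → Setoid.refl ℝ-setoid) (+-closed f∈ g∈)
  ; Bic-closed     = λ φ∈ f∈ → resp-≈ (λ _ → Setoid.refl ℝ-setoid) (Bic-closed φ∈ f∈)
  ; uniform-closed = λ approx → uniform-closed λ ε 0<ε →
      -- A uniform bound on all of `Y` restricts to the values of `h`, so the approximants of `f`,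
      -- composed with `h`, approximate `f ∘ h` with the same `ε`.
      let g , g∘h∈ , close = approx ε 0<ε in
      g ∘ h , g∘h∈ , λ x → close (h ⟨$⟩ x)
  }
  where open IsBishopTopology isTop

module _ {I : DirectedSet c ℓ₁ ℓ₂}
         {S : DirectSpectrum I a ℓ p} {T : DirectSpectrum I b m q}
         (Ψ : SpectrumMap S T) where

  private
    module S = DirectSpectrum S
    module T = DirectSpectrum T
    module Ψ = SpectrumMap Ψ

  Lim-map : Limₛ S ⟶ₛ Limₛ T
  Lim-map = record
    { to   = λ (eql₀ (i , x)) → eql₀ (i , Ψ.Ψ i ⟨$⟩ x)
    ; cong = λ {(eql₀ (i , x))} {(eql₀ (j , y))} (k , i≼k , j≼k , e) →
        let open ≈-Reasoning (T.λ₀ k) in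
        k , i≼k , j≼k , (begin
          T.λ≼ i≼k ⟨$⟩ (Ψ.Ψ i ⟨$⟩ x)  ≈⟨ Ψ.natural i≼k x ⟨
          Ψ.Ψ k ⟨$⟩ (S.λ≼ i≼k ⟨$⟩ x)  ≈⟨ Func.cong (Ψ.Ψ k) e ⟩
          Ψ.Ψ k ⟨$⟩ (S.λ≼ j≼k ⟨$⟩ y)  ≈⟨ Ψ.natural j≼k y ⟩
          T.λ≼ j≼k ⟨$⟩ (Ψ.Ψ j ⟨$⟩ y)  ∎)
    }

  -- Continuity of `Ψ` supplies membership at each index; compatibility comes from naturality.
  ∏≽F-pullback : IsContinuous Ψ → ∏≽F T → ∏≽F S
  ∏≽F-pullback cont θ = record
    { Θ          = λ i → Θ i ∘ Ψ.Ψ i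
    ; Θ∈F        = λ i → cont i (Θ i) (Θ∈F i)
    ; compatible = λ {i} {j} i≼j x →
        let open ≈-Reasoning ℝ-setoid in begin
        Θ i ⟨$⟩ (Ψ.Ψ i ⟨$⟩ x)                 ≈⟨ compatible i≼j (Ψ.Ψ i ⟨$⟩ x) ⟩
        Θ j ⟨$⟩ (T.λ≼ i≼j ⟨$⟩ (Ψ.Ψ i ⟨$⟩ x))  ≈⟨ Func.cong (Θ j) (Ψ.natural i≼j x) ⟨
        Θ j ⟨$⟩ (Ψ.Ψ j ⟨$⟩ (S.λ≼ i≼j ⟨$⟩ x))  ∎
    }
    where open ∏≽F θ

  Lim-map-Mor : IsContinuous Ψ → Lim-map ∈ Mor (Lim S) (Lim T)
  Lim-map-Mor cont g = ⋁-least
    (pullback-isBishopTopology (⋁-isBishopTopology (eql₀f-image S)) Lim-map)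
    -- A generator pulls back to a generator: `eql₀f θ` after `Lim-map` has the values of `eql₀f` at
    -- the pulled-back family.
    λ (θ , f≈θ) → base (∏≽F-pullback cont θ , λ x → f≈θ (Lim-map ⟨$⟩ x))

  Lim-map-IsEmbedding : (∀ i → Ψ.Ψ i ∈ IsEmbedding) → Lim-map ∈ IsEmbedding
  Lim-map-IsEmbedding emb {eql₀ (i , x)} {eql₀ (j , y)} (k , i≼k , j≼k , e) =
    -- The stage `k` where the images agree already serves for the arguments, since `Ψ k` can be
    -- cancelled there.
    k , i≼k , j≼k , emb k (begin
      Ψ.Ψ k ⟨$⟩ (S.λ≼ i≼k ⟨$⟩ x)  ≈⟨ Ψ.natural i≼k x ⟩
      T.λ≼ i≼k ⟨$⟩ (Ψ.Ψ i ⟨$⟩ x)  ≈⟨ e ⟩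
      T.λ≼ j≼k ⟨$⟩ (Ψ.Ψ j ⟨$⟩ y)  ≈⟨ Ψ.natural j≼k y ⟨
      Ψ.Ψ k ⟨$⟩ (S.λ≼ j≼k ⟨$⟩ y)  ∎)
    where open ≈-Reasoning (T.λ₀ k)

theorem9p8 : ∀ {c ℓ₁ ℓ₂ a ℓ p b m q : Level}
  (I : DirectedSet c ℓ₁ ℓ₂)
  (S : DirectSpectrum I a ℓ p) (T : DirectSpectrum I b m q)
  (Ψ : SpectrumMap S T) →
  let module I = DirectedSet I
      module S = DirectSpectrum S
      module T = DirectSpectrum T
      module Ψ = SpectrumMap Ψ
  in
  Σ (∃! (FunctionEquality._≈_ (Limₛ S) (Limₛ T))
        (λ (Φ : Limₛ S ⟶ₛ Limₛ T) → ∀ (i : I.Carrier) →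
          FunctionEquality._≈_ (S.λ₀ i) (Limₛ T) (Φ ∘ eql S i) (eql T i ∘ Ψ.Ψ i)))
    (λ (Ψ→ , _) →
      (IsContinuous Ψ → Ψ→ ∈ Mor (Lim S) (Lim T))
      × ((∀ i → Ψ.Ψ i ∈ IsEmbedding) → Ψ→ ∈ IsEmbedding))
theorem9p8 I S T Ψ =
  ( Lim-map Ψ
  , (λ i x → Setoid.refl (Limₛ T))
  -- Uniqueness: the equation for `Φ` at index `i` and point `x` is already its value on
  -- `eql₀ (i , x)`.
  , λ {Φ} Φ-eql (eql₀ (i , x)) →
      Setoid.sym (Limₛ T) {Φ ⟨$⟩ eql₀ (i , x)} {Lim-map Ψ ⟨$⟩ eql₀ (i , x)} (Φ-eql i x)
  ) , Lim-map-Mor Ψ , Lim-map-IsEmbedding Ψ
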